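{- Let $n,s,t,\delta$ be integers with $s\ge 2$ and $4\le 2t\le \delta\le \left\lfloor \frac{n+t-1}{2}\right\rfloor$, and let $h=\left\lfloor \frac{n+t-1}{2}\right\rfloor$. Put $$f_0(n,t,\delta,s)=\binom{n+t-\delta}{s}+(\delta-t)\binom{\delta}{s-1},$$ $$g_0(n,t,\delta,s)=\binom{n+t-h}{s}+(h-t-1)\binom{h}{s-1}+\binom{\delta}{s-1}.$$ Let $G$ be a finite, simple, connected graph of order $n$ with minimum degree $\delta$. If $$N_s(G)>\max\{f_0(n,t,\delta,s),\,g_0(n,t,\delta,s)\},$$ then $G$ is many-to-many $t$-disjoint path coverable.
   Context: The order of a graph is its number of vertices. $N_s(G)$ is the number of $s$-cliques of $G$, i.e. of sets of exactly $s$ vertices of $G$ that are pairwise adjacent. A graph $G$ is many-to-many $t$-disjoint path coverable if for any two disjoint vertex subsets $U=\{u_1,\dots,u_t\}$ and $V=\{v_1,\dots,v_t\}$ of $G$, each consisting of $t$ distinct vertices, there exist a permutation $\tau$ of $\{1,\dots,t\}$ and $t$ paths $P_1,\dots,P_t$ in $G$ such that $P_i$ joins $u_i$ and $v_{\tau(i)}$ and every vertex of $G$ belongs to exactly one of the paths. Binomial coefficients $\binom{a}{b}$ with integers $0\le a<b$ are $0$. -}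

module Defs where

open import Data.Fin.Base using (Fin)
open import Data.Fin.Permutation using (Permutation′; _⟨$⟩ʳ_)
open import Data.Fin.Properties using (_≟_; all?)
open import Data.Fin.Subset using (Subset; inside; outside; ∣_∣)
  renaming (_∈_ to _∈ₛ_)
open import Data.Fin.Subset.Properties using () renaming (_∈?_ to _∈ₛ?_)
open import Data.List.Base using (List; []; _∷_; _++_; map; filter; length; head; last)
open import Data.List.Membership.Propositional using (_∈_)
open import Data.List.Relation.Unary.Linked using (Linked)
open import Data.List.Relation.Unary.Unique.Propositional using (Unique)
open import Data.Maybe.Base using (just)
open import Data.Nat.Base using (ℕ; zero; suc; _+_; _*_; _∸_; _≤_; ⌊_/2⌋)
open import Data.Nat.Combinatorics using (_C_)
import Data.Nat.Properties as ℕ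
open import Data.Product using (Σ; ∃; ∃!; _×_)
open import Data.Vec.Base using ([]; _∷_; tabulate)
open import Function.Definitions using (Injective)
open import Level using (0ℓ)
open import Relation.Binary.Core using (Rel)
open import Relation.Binary.Definitions using (Symmetric; Irreflexive; Decidable)
open import Relation.Binary.PropositionalEquality using (_≡_; _≢_)
open import Relation.Nullary using (Dec; does; ¬?; _×-dec_; _→-dec_)

-- A finite simple graph of order n, on the vertex set Fin n.
record Graph (n : ℕ) : Set₁ where
  field
    Adj    : Rel (Fin n) 0ℓ
    adj?   : Decidable Adj
    symm   : Symmetric Adj
    irrefl : Irreflexive _≡_ Adj

module _ {n : ℕ} (G : Graph n) where
  open Graph G

  neighbours : Fin n → Subset n
  neighbours v = tabulate (λ w → does (adj? v w))

  degree : Fin n → ℕ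
  degree v = ∣ neighbours v ∣

  HasMinDegree : ℕ → Set
  HasMinDegree δ = (∀ v → δ ≤ degree v) × ∃ (λ v → degree v ≡ δ)

  IsClique : ℕ → Subset n → Set
  IsClique s p = ∣ p ∣ ≡ s × (∀ x y → x ∈ₛ p → y ∈ₛ p → x ≢ y → Adj x y)

  isClique? : ∀ s p → Dec (IsClique s p)
  isClique? s p = (∣ p ∣ ℕ.≟ s) ×-dec
    all? (λ x → all? (λ y →
      (x ∈ₛ? p) →-dec ((y ∈ₛ? p) →-dec (¬? (x ≟ y) →-dec adj? x y))))

  -- The vertices are listed in order of traversal, without repetition, so a
  -- path from u to u consists of u alone.
  record Path (u v : Fin n) : Set where
    field
      vertices : List (Fin n)
      linked   : Linked Adj vertices
      distinct : Unique vertices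
      starts   : head vertices ≡ just u
      ends     : last vertices ≡ just v

  Connected : Set
  Connected = ∀ u v → Path u v

  -- The disjoint sets U and V are given by injective enumerations u and v.
  ManyToManyDisjointPathCoverable : ℕ → Set
  ManyToManyDisjointPathCoverable t =
    (u v : Fin t → Fin n) →
    Injective _≡_ _≡_ u → Injective _≡_ _≡_ v → (∀ i j → u i ≢ v j) →
    Σ (Permutation′ t) λ τ →
    Σ ((i : Fin t) → Path (u i) (v (τ ⟨$⟩ʳ i))) λ P →
      ∀ x → ∃! _≡_ (λ i → x ∈ Path.vertices (P i))

-- Every subset of Fin n occurs exactly once.
allSubsets : ∀ n → List (Subset n)
allSubsets zero    = [] ∷ []
allSubsets (suc n) = map (outside ∷_) (allSubsets n) ++ map (inside ∷_) (allSubsets n)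

-- N s G is the number of s-cliques of G.
N : ∀ {n} → ℕ → Graph n → ℕ
N {n} s G = length (filter (isClique? G s) (allSubsets n))

-- For 4 ≤ 2t ≤ δ ≤ h n t and 2 ≤ s, every subtraction below has a nonnegative
-- value over the integers, so ∸ never truncates.

h : ℕ → ℕ → ℕ
h n t = ⌊ n + t ∸ 1 /2⌋

f₀ : (n t δ s : ℕ) → ℕ
f₀ n t δ s = ((n + t ∸ δ) C s) + (δ ∸ t) * (δ C (s ∸ 1))

g₀ : (n t δ s : ℕ) → ℕ
g₀ n t δ s =
  ((n + t ∸ h n t) C s) + (h n t ∸ t ∸ 1) * (h n t C (s ∸ 1)) + (δ C (s ∸ 1))

{-# OPTIONS --safe #-}
module Submission where

-- Degrees: if nonadjacent x and y satisfy d(x) + d(y) ≥ n + t, then an oriented path cover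
-- of G + xy from U to V can be turned into one of G.  Indeed, if the cover uses xy, deleting
-- it leaves ends x and y, and unless the loose ends can be reconnected along some other edge
-- w w′ of the cover, counting yields d(x) + d(y) ≤ n + t - 1.  Adding edges one by one, either
-- G becomes complete and a cover is obvious, or at some stage all nonadjacent pairs have
-- degree sum below n + t; then, for a nonadjacent pair of maximal degree sum with smaller
-- degree k, we have δ ≤ k ≤ h and at least k - t vertices have degree at most k.
--
-- Cliques: in the latter case choose k - t vertices that have degree at most k in the original
-- graph, one of them of degree δ.  Removing them one at a time shows that N_s(G) is at most
-- C(n+t-k, s) + (k-t-1) C(k, s-1) + C(δ, s-1).  This is convex in k, and its values at
-- k = δ and k = h are f₀ and g₀.

open import Defs
open import Algebra.Properties.CommutativeSemigroup using (interchange)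
open import Data.Fin.Base using (Fin; zero; suc)
open import Data.Fin.Permutation using (Permutation′; permutation; _⟨$⟩ʳ_)
open import Data.Fin.Properties using (_≟_)
open import Data.Fin.Subset using (Subset; inside; outside; ∣_∣; _⊆_; _∪_; _-_; ⁅_⁆; ⊤)
  renaming (_∈_ to _∈ₛ_; _∉_ to _∉ₛ_)
open import Data.Fin.Subset.Properties
  using (_⊆?_; out⊆; s⊆s; drop-∷-⊆; ∪-identityʳ; x∈p∪q⁺; x∈⁅x⁆;
         x∈p∧x≢y⇒x∈p-y; x∈p⇒∣p-x∣<∣p∣; ∈⊤; ⊆⊤; ∣⊤∣≡n)
  renaming (_∈?_ to _∈ₛ?_)
open import Data.List.Base as List
  using (List; []; _∷_; _++_; map; filter; length; take; allFin; tabulate; concat;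
         cartesianProduct; head; last)
open import Data.List.Properties
  using (filter-++; filter-≐; length-++; length-take; length-tabulate; ++-assoc)
open import Data.List.Membership.Propositional using (_∈_; _∉_)
import Data.List.Membership.DecPropositional as DecMembership
open import Data.List.Membership.Propositional.Properties
  using (∈-++⁺ˡ; ∈-++⁺ʳ; ∈-++⁻; ∈-allFin; ∈-tabulate⁺; ∈-tabulate⁻; ∈-filter⁺; ∈-filter⁻;
         ∈-cartesianProduct⁺)
open import Data.List.Membership.Propositional.Properties.WithK using (unique∧set⇒bag)
open import Data.List.Relation.Binary.BagAndSetEquality using (∼bag⇒↭)
open import Data.List.Relation.Binary.Permutation.Propositional as ↭
  using (_↭_; prep; swap; ↭-refl; ↭-sym; ↭-trans; ↭-reflexive)
open import Data.List.Relation.Binary.Permutation.Propositional.Properties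
  using (++⁺ˡ; ++⁺ʳ; ++-comm; shift; shifts; ∈-resp-↭; ↭-length)
import Data.List.Relation.Binary.Permutation.Setoid.Properties as ↭ₛ
open import Data.List.Relation.Unary.All as All using (All; []; _∷_)
import Data.List.Relation.Unary.All.Properties as All
open import Data.List.Relation.Unary.AllPairs using ([]; _∷_)
open import Data.List.Relation.Unary.Any using (here; there)
open import Data.List.Relation.Unary.Linked using (Linked; [-]; _∷_)
open import Data.List.Relation.Unary.Unique.Propositional using (Unique)
import Data.List.Relation.Unary.Unique.Propositional.Properties as Unique
open import Data.Maybe.Base using (just)
open import Data.Nat using
  (ℕ; zero; suc; _+_; _*_; _∸_; _≤_; _<_; _>_; _⊔_; z≤n; s≤s; _≤?_; ⌊_/2⌋)
open import Data.Nat.Combinatorics using (_C_; nCk+nC[k+1]≡[n+1]C[k+1])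
open import Data.Nat.ListAction using (sum)
import Data.Nat.Properties as ℕ
open import Data.Nat.Properties hiding (_≟_)
open import Data.List.Extrema ≤-totalOrder using (argmax; argmax-all; f[xs]≤f[argmax])
open import Data.Nat.Solver using (module +-*-Solver)
open import Data.Product using (Σ; ∃; ∃₂; ∃!; _×_; _,_; proj₁; proj₂)
open import Data.Sum using (_⊎_; inj₁; inj₂)
open import Data.Vec.Base as Vec using ([]; _∷_; here; there)
import Data.Vec.Properties as Vec
open import Function using (_∘_; id; case_of_; Injective; mk⇔)
open import Level using (Level; 0ℓ)
open import Relation.Binary using (Rel; Symmetric; Irreflexive) renaming (Decidable to Decidable₂)
open import Relation.Binary.PropositionalEquality
  using (_≡_; _≢_; refl; sym; trans; cong; cong₂; subst; subst₂; setoid)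
open import Relation.Nullary using (¬_; yes; no; does; ¬?; _×-dec_; _⊎-dec_; contradiction)
open import Relation.Nullary.Decidable using (dec-true; dec-false)
open import Relation.Unary using (Pred; Decidable)

private variable
  ℓ ℓ₁ ℓ₂ ℓ₃ : Level
  A : Set ℓ

-- Counting the entries of a list

# : {P : Pred A ℓ₁} → Decidable P → List A → ℕ
# P? xs = length (filter P? xs)

module _ {P : Pred A ℓ₁} (P? : Decidable P) where

  #-++ : ∀ xs ys → # P? (xs ++ ys) ≡ # P? xs + # P? ys
  #-++ xs ys = trans (cong length (filter-++ P? xs ys)) (length-++ (filter P? xs))

  #-yes : ∀ {x} xs → P x → # P? (x ∷ xs) ≡ suc (# P? xs)
  #-yes {x} xs px with P? x
  ... | yes _  = refl
  ... | no ¬px = contradiction px ¬px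

  #-no : ∀ {x} xs → ¬ P x → # P? (x ∷ xs) ≡ # P? xs
  #-no {x} xs ¬px with P? x
  ... | yes px = contradiction px ¬px
  ... | no _   = refl

  #-∷-≤ : ∀ x xs → # P? (x ∷ xs) ≤ suc (# P? xs)
  #-∷-≤ x xs with P? x
  ... | yes _ = ≤-refl
  ... | no _  = n≤1+n _

  #-≤-∷ : ∀ x xs → # P? xs ≤ # P? (x ∷ xs)
  #-≤-∷ x xs with P? x
  ... | yes _ = n≤1+n _
  ... | no _  = ≤-refl

  #-map : {B : Set ℓ} (f : B → A) (xs : List B) → # P? (map f xs) ≡ # (P? ∘ f) xs
  #-map f []       = refl
  #-map f (x ∷ xs) with P? (f x)
  ... | yes _ = cong suc (#-map f xs)
  ... | no _  = #-map f xs

  #-∷∷ : ∀ x y xs → # P? (x ∷ y ∷ xs) ≡ # P? (x ∷ []) + # P? (y ∷ []) + # P? xs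
  #-∷∷ x y xs = trans (#-++ (x ∷ y ∷ []) xs) (cong (_+ # P? xs) (#-++ (x ∷ []) (y ∷ [])))

  #-↭ : ∀ {xs ys} → xs ↭ ys → # P? xs ≡ # P? ys
  #-↭ ↭.refl = refl
  #-↭ (prep x σ) with P? x
  ... | yes _ = cong suc (#-↭ σ)
  ... | no _  = #-↭ σ
  #-↭ (swap {xs} {ys} x y σ) = trans (#-∷∷ x y xs) (trans
    (cong₂ _+_ (+-comm (# P? (x ∷ [])) _) (#-↭ σ)) (sym (#-∷∷ y x ys)))
  #-↭ (↭.trans σ τ) = trans (#-↭ σ) (#-↭ τ)

  #-none : (∀ x → ¬ P x) → ∀ xs → # P? xs ≡ 0
  #-none ¬p []       = refl
  #-none ¬p (x ∷ xs) = trans (#-no xs (¬p x)) (#-none ¬p xs)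

  #-complement : ∀ xs → # P? xs + # (¬? ∘ P?) xs ≡ length xs
  #-complement [] = refl
  #-complement (x ∷ xs) with P? x
  ... | yes _ = cong suc (#-complement xs)
  ... | no _  = trans (+-suc _ _) (cong suc (#-complement xs))

  -- Degrees are cardinalities of subsets, while walks carry lists; this turns a degree into a count
  -- over a list of the vertices.
  ∣tabulate∣ : ∀ {n} (f : Fin n → A) →
    ∣ Vec.tabulate (λ i → does (P? (f i))) ∣ ≡ # P? (List.tabulate f)
  ∣tabulate∣ {n = zero}  f = refl
  ∣tabulate∣ {n = suc n} f with P? (f zero)
  ... | yes _ = cong suc (∣tabulate∣ (f ∘ suc))
  ... | no _  = ∣tabulate∣ (f ∘ suc)

module _ {P : Pred A ℓ₁} {Q : Pred A ℓ₂} (P? : Decidable P) (Q? : Decidable Q) where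

  #-mono : (∀ x → P x → Q x) → ∀ xs → # P? xs ≤ # Q? xs
  #-mono P⊆Q [] = z≤n
  #-mono P⊆Q (x ∷ xs) with P? x | Q? x
  ... | yes _  | yes _  = s≤s (#-mono P⊆Q xs)
  ... | yes px | no ¬qx = contradiction (P⊆Q x px) ¬qx
  ... | no _   | yes _  = m≤n⇒m≤1+n (#-mono P⊆Q xs)
  ... | no _   | no _   = #-mono P⊆Q xs

  #-cong : (∀ x → P x → Q x) → (∀ x → Q x → P x) → ∀ xs → # P? xs ≡ # Q? xs
  #-cong P⊆Q Q⊆P xs = cong length (filter-≐ P? Q? ((λ {x} → P⊆Q x) , (λ {x} → Q⊆P x)) xs)

  #-strict : (∀ x → P x → Q x) → ∀ {z xs} → z ∈ xs → Q z → ¬ P z → # P? xs < # Q? xs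
  #-strict P⊆Q {xs = x ∷ xs} (here refl) qz ¬pz =
    subst₂ _<_ (sym (#-no P? xs ¬pz)) (sym (#-yes Q? xs qz)) (s≤s (#-mono P⊆Q xs))
  #-strict P⊆Q {xs = x ∷ xs} (there z∈) qz ¬pz with P? x | Q? x
  ... | yes _  | yes _  = s≤s (#-strict P⊆Q z∈ qz ¬pz)
  ... | yes px | no ¬qx = contradiction (P⊆Q x px) ¬qx
  ... | no _   | yes _  = m≤n⇒m≤1+n (#-strict P⊆Q z∈ qz ¬pz)
  ... | no _   | no _   = #-strict P⊆Q z∈ qz ¬pz

  module _ {R : Pred A ℓ₃} (R? : Decidable R) where

    #-cover : (∀ x → R x → P x ⊎ Q x) → ∀ xs → # R? xs ≤ # P? xs + # Q? xs
    #-cover c [] = z≤n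
    #-cover c (x ∷ xs) with R? x
    ... | no _ = ≤-trans (#-cover c xs) (+-mono-≤ (#-≤-∷ P? x xs) (#-≤-∷ Q? x xs))
    ... | yes rx with c x rx
    ... | inj₁ px = ≤-trans (s≤s (#-cover c xs))
          (+-mono-≤ (≤-reflexive (sym (#-yes P? xs px))) (#-≤-∷ Q? x xs))
    ... | inj₂ qx = ≤-trans (s≤s (#-cover c xs)) (≤-trans (≤-reflexive (sym (+-suc _ _)))
          (+-mono-≤ (#-≤-∷ P? x xs) (≤-reflexive (sym (#-yes Q? xs qx)))))

    #-disjoint : (∀ x → P x → R x × ¬ Q x) → (∀ x → Q x → R x) →
                 ∀ xs → # P? xs + # Q? xs ≤ # R? xs
    #-disjoint P⊆ Q⊆ [] = z≤n
    #-disjoint P⊆ Q⊆ (x ∷ xs) with ih ← #-disjoint P⊆ Q⊆ xs | P? x | Q? x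
    ... | yes px | yes qx = contradiction qx (proj₂ (P⊆ x px))
    ... | yes px | no _   = ≤-trans (s≤s ih) (≤-reflexive (sym (#-yes R? xs (proj₁ (P⊆ x px)))))
    ... | no _   | yes qx = ≤-trans (≤-reflexive (+-suc _ _))
                              (≤-trans (s≤s ih) (≤-reflexive (sym (#-yes R? xs (Q⊆ x qx)))))
    ... | no _   | no _   = ≤-trans ih (#-≤-∷ R? x xs)

#-single : ∀ {n} v {xs : List (Fin n)} → Unique xs → # (_≟ v) xs ≤ 1
#-single v [] = z≤n
#-single v {x ∷ xs} (x∉xs ∷ xs!) with x ≟ v
... | no _     = #-single v xs!
... | yes refl = s≤s (≤-reflexive (absent x∉xs))
  where
  absent : ∀ {xs} → All (v ≢_) xs → # (_≟ v) xs ≡ 0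
  absent []                   = refl
  absent {x ∷ xs} (v≢x ∷ v∉xs) = trans (#-no (_≟ v) xs (v≢x ∘ sym)) (absent v∉xs)

-- Binomial coefficients

pascal : ∀ n k → suc n C suc k ≡ n C suc k + n C k
pascal n k = trans (sym (nCk+nC[k+1]≡[n+1]C[k+1] n k)) (+-comm (n C k) _)

C-mono : ∀ {m n} k → m ≤ n → m C k ≤ n C k
C-mono zero    m≤n = ≤-refl
C-mono (suc k) z≤n = z≤n
C-mono (suc k) (s≤s {m} {n} m≤n) = ≤-trans (≤-reflexive (pascal m k))
  (≤-trans (+-mono-≤ (C-mono (suc k) m≤n) (C-mono k m≤n)) (≤-reflexive (sym (pascal n k))))

-- Cliques

sub? : ∀ {n} s (q : Subset n) → Decidable (λ p → ∣ p ∣ ≡ s × p ⊆ q)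
sub? s q p = (∣ p ∣ ℕ.≟ s) ×-dec (p ⊆? q)

#-subsets : ∀ n s (q : Subset n) → # (sub? s q) (allSubsets n) ≡ ∣ q ∣ C s
#-subsets zero zero [] = refl
#-subsets zero (suc s) [] = refl
#-subsets (suc n) s (b ∷ q) =
  trans (#-++ D? (map (outside ∷_) S) (map (inside ∷_) S))
  (trans (cong₂ _+_ (trans (#-map D? (outside ∷_) S) out) (#-map D? (inside ∷_) S)) (step s b))
  where
  S = allSubsets n
  D? = sub? s (b ∷ q)
  out : # (D? ∘ (outside ∷_)) S ≡ ∣ q ∣ C s
  out = trans (#-cong (D? ∘ (outside ∷_)) (sub? s q)
    (λ _ (e , i) → e , drop-∷-⊆ i) (λ _ (e , i) → e , out⊆ i) S) (#-subsets n s q)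
  step : ∀ s b → ∣ q ∣ C s + # (sub? s (b ∷ q) ∘ (inside ∷_)) S ≡ ∣ b ∷ q ∣ C s
  step s outside = trans (cong (∣ q ∣ C s +_)
    (#-none (sub? s (outside ∷ q) ∘ (inside ∷_)) (λ p (_ , i) → case (i here) of λ ()) S)) (+-identityʳ _)
  step zero inside = cong suc
    (#-none (sub? zero (inside ∷ q) ∘ (inside ∷_)) (λ { p (() , _) }) S)
  step (suc s) inside = trans (cong (∣ q ∣ C suc s +_)
    (trans (#-cong (sub? (suc s) (inside ∷ q) ∘ (inside ∷_)) (sub? s q)
      (λ _ (e , i) → suc-injective e , drop-∷-⊆ i) (λ _ (e , i) → cong suc e , s⊆s i) S)
      (#-subsets n s q)))
    (sym (pascal ∣ q ∣ s))

∣p∪⁅x⁆∣≤1+∣p∣ : ∀ {n} (p : Subset n) x → ∣ p ∪ ⁅ x ⁆ ∣ ≤ suc ∣ p ∣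
∣p∪⁅x⁆∣≤1+∣p∣ (outside ∷ p) zero rewrite ∪-identityʳ p = ≤-refl
∣p∪⁅x⁆∣≤1+∣p∣ (inside ∷ p)  zero rewrite ∪-identityʳ p = n≤1+n _
∣p∪⁅x⁆∣≤1+∣p∣ (outside ∷ p) (suc x) = ∣p∪⁅x⁆∣≤1+∣p∣ p x
∣p∪⁅x⁆∣≤1+∣p∣ (inside ∷ p)  (suc x) = s≤s (∣p∪⁅x⁆∣≤1+∣p∣ p x)

subThrough? : ∀ {n} s (v : Fin n) (q : Subset n) →
  Decidable (λ p → v ∈ₛ p × (∣ p ∣ ≡ s × p ⊆ q))
subThrough? s v q p = (v ∈ₛ? p) ×-dec sub? s q p

-- The sets through `v` and the sets inside `q` are disjoint families of subsets of `q ∪ ⁅ v ⁆`, all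
-- of size `suc r`. Subtracting the second family leaves `∣ q ∣ C r` by Pascal's rule.
#-subsets-through : ∀ {n} r (v : Fin n) (q : Subset n) → v ∉ₛ q →
  # (subThrough? (suc r) v (q ∪ ⁅ v ⁆)) (allSubsets n) ≤ ∣ q ∣ C r
#-subsets-through {n} r v q v∉q = +-cancelʳ-≤ (∣ q ∣ C suc r) _ _ (begin
  # through? S + ∣ q ∣ C suc r            ≡⟨ cong (# through? S +_) (#-subsets n (suc r) q) ⟨
  # through? S + # (sub? (suc r) q) S     ≤⟨ #-disjoint through? (sub? (suc r) q) (sub? (suc r) (q ∪ ⁅ v ⁆))
                                              (λ p (v∈p , sp) → sp , λ (_ , p⊆q) → v∉q (p⊆q v∈p))
                                              (λ p (e , p⊆q) → e , x∈p∪q⁺ ∘ inj₁ ∘ p⊆q) S ⟩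
  # (sub? (suc r) (q ∪ ⁅ v ⁆)) S           ≡⟨ #-subsets n (suc r) (q ∪ ⁅ v ⁆) ⟩
  ∣ q ∪ ⁅ v ⁆ ∣ C suc r                    ≤⟨ C-mono (suc r) (∣p∪⁅x⁆∣≤1+∣p∣ q v) ⟩
  suc ∣ q ∣ C suc r                        ≡⟨ nCk+nC[k+1]≡[n+1]C[k+1] ∣ q ∣ r ⟨
  ∣ q ∣ C r + ∣ q ∣ C suc r                ∎)
  where
  open ≤-Reasoning
  S = allSubsets n
  through? = subThrough? (suc r) v (q ∪ ⁅ v ⁆)

module _ {n} (G : Graph n) where
  open Graph G

  ∈-neighbours⁺ : ∀ {v w} → Adj v w → w ∈ₛ neighbours G v
  ∈-neighbours⁺ {v} {w} e = Vec.lookup⇒[]= w _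
    (trans (Vec.lookup∘tabulate (λ w → does (adj? v w)) w) (dec-true (adj? v w) e))

  v∉neighbours : ∀ v → v ∉ₛ neighbours G v
  v∉neighbours v v∈ with () ← trans (sym (Vec.[]=⇒lookup v∈))
    (trans (Vec.lookup∘tabulate (λ w → does (adj? v w)) v) (dec-false (adj? v v) (irrefl refl)))

  cliqueIn? : ∀ s q → Decidable (λ p → IsClique G s p × p ⊆ q)
  cliqueIn? s q p = isClique? G s p ×-dec (p ⊆? q)

  -- Peel off the vertices of `S` in turn. A clique through `v` lies in the closed neighbourhood of
  -- `v`, which accounts for at most `degree G v C r` cliques; every other clique survives in
  -- `q - v`. Once `S` is exhausted, all subsets of the right size are counted.
  #-cliques-≤ : ∀ r S q → Unique S → All (_∈ₛ q) S →
    # (cliqueIn? (suc r) q) (allSubsets n) ≤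
      (∣ q ∣ ∸ length S) C suc r + sum (map (λ v → degree G v C r) S)
  #-cliques-≤ r [] q _ _ = ≤-trans
    (#-mono (cliqueIn? (suc r) q) (sub? (suc r) q) (λ p ((e , _) , i) → e , i) (allSubsets n))
    (≤-reflexive (trans (#-subsets n (suc r) q) (sym (+-identityʳ _))))
  #-cliques-≤ r (v ∷ S) q (v∉S ∷ S!) (v∈q ∷ S⊆q) = begin
    # (cliqueIn? (suc r) q) (allSubsets n)
      ≤⟨ #-cover (cliqueIn? (suc r) (q - v)) through? (cliqueIn? (suc r) q) split (allSubsets n) ⟩
    # (cliqueIn? (suc r) (q - v)) (allSubsets n) + # through? (allSubsets n)
      ≤⟨ +-mono-≤ (#-cliques-≤ r S (q - v) S! (All.zipWith
                    (λ (x∈q , v≢x) → x∈p∧x≢y⇒x∈p-y x∈q (v≢x ∘ sym)) (S⊆q , v∉S)))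
                  (#-subsets-through r v (neighbours G v) (v∉neighbours v)) ⟩
    (∣ q - v ∣ ∸ length S) C suc r + sum (map (λ v → degree G v C r) S) + degree G v C r
      ≤⟨ +-monoˡ-≤ _ (+-monoˡ-≤ _ (C-mono (suc r) (≤-trans (∸-monoˡ-≤ (length S) smaller)
           (≤-reflexive (∸-+-assoc ∣ q ∣ 1 (length S)))))) ⟩
    (∣ q ∣ ∸ suc (length S)) C suc r + sum (map (λ v → degree G v C r) S) + degree G v C r
      ≡⟨ trans (+-assoc ((∣ q ∣ ∸ suc (length S)) C suc r) _ _)
               (cong ((∣ q ∣ ∸ suc (length S)) C suc r +_) (+-comm _ (degree G v C r))) ⟩
    (∣ q ∣ ∸ suc (length S)) C suc r + (degree G v C r + sum (map (λ v → degree G v C r) S)) ∎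
    where
    open ≤-Reasoning
    through? = subThrough? (suc r) v (neighbours G v ∪ ⁅ v ⁆)
    smaller : ∣ q - v ∣ ≤ ∣ q ∣ ∸ 1
    smaller = ≤-pred (≤-trans (x∈p⇒∣p-x∣<∣p∣ v∈q)
      (≤-reflexive (sym (m+[n∸m]≡n {1} (≤-trans (s≤s z≤n) (x∈p⇒∣p-x∣<∣p∣ v∈q))))))
    split : ∀ p → IsClique G (suc r) p × p ⊆ q →
      (IsClique G (suc r) p × p ⊆ q - v) ⊎ (v ∈ₛ p × (∣ p ∣ ≡ suc r × p ⊆ neighbours G v ∪ ⁅ v ⁆))
    split p ((e , adj) , p⊆q) with v ∈ₛ? p
    ... | no v∉p  = inj₁ ((e , adj) , λ {x} x∈p → x∈p∧x≢y⇒x∈p-y (p⊆q x∈p) λ { refl → v∉p x∈p })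
    ... | yes v∈p = inj₂ (v∈p , e , near)
      where
      near : p ⊆ neighbours G v ∪ ⁅ v ⁆
      near {x} x∈p with x ≟ v
      ... | yes refl = x∈p∪q⁺ (inj₂ (x∈⁅x⁆ v))
      ... | no x≢v   = x∈p∪q⁺ (inj₁ (∈-neighbours⁺ (adj v x v∈p x∈p (x≢v ∘ sym))))

  degree≡# : ∀ v → degree G v ≡ # (adj? v) (allFin n)
  degree≡# v = ∣tabulate∣ (adj? v) id

  degree≤? : ∀ k → Decidable (λ v → degree G v ≤ k)
  degree≤? k v = degree G v ≤? k

  -- Peel off `v₀` and `m` further vertices of degree at most `k`. Keeping `v₀` apart gives its term
  -- the exact degree, which is smallest when `v₀` has minimum degree.
  N-≤ : ∀ r m k v₀ → degree G v₀ ≤ k → suc m ≤ # (degree≤? k) (allFin n) →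
    N (suc r) G ≤ (n ∸ suc m) C suc r + m * (k C r) + degree G v₀ C r
  N-≤ r m k v₀ d₀≤k many = begin
    N (suc r) G
      ≤⟨ #-mono (isClique? G (suc r)) (cliqueIn? (suc r) ⊤) (λ p c → c , ⊆⊤) (allSubsets n) ⟩
    # (cliqueIn? (suc r) ⊤) (allSubsets n)
      ≤⟨ #-cliques-≤ r (v₀ ∷ S) ⊤ (All.tabulate v₀∉S ∷ S!) (All.tabulate (λ _ → ∈⊤)) ⟩
    (∣ ⊤ {n = n} ∣ ∸ suc (length S)) C suc r + (degree G v₀ C r + sum (map (λ v → degree G v C r) S))
      ≤⟨ +-mono-≤ (≤-reflexive (cong₂ (λ a b → (a ∸ suc b) C suc r) (∣⊤∣≡n n) |S|))
                  (≤-trans (+-monoʳ-≤ _ (≤-trans (sum-≤ S S-small)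
                             (≤-reflexive (cong (_* (k C r)) |S|))))
                           (≤-reflexive (+-comm (degree G v₀ C r) (m * (k C r))))) ⟩
    (n ∸ suc m) C suc r + (m * (k C r) + degree G v₀ C r)
      ≡⟨ +-assoc ((n ∸ suc m) C suc r) _ _ ⟨
    (n ∸ suc m) C suc r + m * (k C r) + degree G v₀ C r ∎
    where
    open ≤-Reasoning
    rest? : Decidable (λ v → degree G v ≤ k × v ≢ v₀)
    rest? v = degree≤? k v ×-dec ¬? (v ≟ v₀)
    L = filter rest? (allFin n)
    S = take m L
    S! : Unique S
    S! = Unique.take⁺ m (Unique.filter⁺ rest? (Unique.allFin⁺ n))
    S-ok : All (λ v → degree G v ≤ k × v ≢ v₀) S
    S-ok = All.take⁺ m (All.all-filter rest? (allFin n))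
    v₀∉S : ∀ {x} → x ∈ S → v₀ ≢ x
    v₀∉S x∈S = proj₂ (All.lookup S-ok x∈S) ∘ sym
    S-small : All (λ v → degree G v ≤ k) S
    S-small = All.map proj₁ S-ok
    -- Excluding `v₀` costs at most one of the `suc m` vertices of low degree.
    enough : m ≤ length L
    enough = ≤-pred (≤-trans many (≤-trans
      (#-cover (_≟ v₀) rest? (degree≤? k) (λ x d → cover x d) (allFin n))
      (+-monoˡ-≤ _ (#-single v₀ (Unique.allFin⁺ n)))))
      where
      cover : ∀ x → degree G x ≤ k → x ≡ v₀ ⊎ (degree G x ≤ k × x ≢ v₀)
      cover x d with x ≟ v₀
      ... | yes e = inj₁ e
      ... | no ne = inj₂ (d , ne)
    |S| : length S ≡ m
    |S| = trans (length-take m L) (m≤n⇒m⊓n≡m enough)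
    sum-≤ : ∀ xs → All (λ v → degree G v ≤ k) xs →
      sum (map (λ v → degree G v C r) xs) ≤ length xs * (k C r)
    sum-≤ [] [] = z≤n
    sum-≤ (x ∷ xs) (px ∷ pxs) = +-mono-≤ (C-mono r px) (sum-≤ xs pxs)

-- Convex sequences

-- Nonnegative second differences, rearranged so that nothing is subtracted in ℕ.
Convex : (ℕ → ℕ) → Set
Convex F = ∀ k → F (suc k) + F (suc k) ≤ F k + F (suc (suc k))

Increasing : (ℕ → ℕ) → Set
Increasing F = ∀ k → F k ≤ F (suc k)

module _ {F : ℕ → ℕ} (cvx : Convex F) where

  -- By convexity a step up is followed by another step up.
  rising : ∀ {k} → F k ≤ F (suc k) → ∀ j → F k ≤ F (k + j)
  rising {k} _ zero = ≤-reflexive (cong F (sym (+-identityʳ k)))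
  rising {k} k≤ (suc j) = ≤-trans k≤ (≤-trans (rising next j) (≤-reflexive (cong F (sym (+-suc k j)))))
    where
    next : F (suc k) ≤ F (suc (suc k))
    next = +-cancelˡ-≤ (F (suc k)) _ _ (≤-trans (cvx k) (+-monoˡ-≤ _ k≤))

  -- Induction on `i`: a step up fixes the second alternative for good by `rising`, and a step down
  -- preserves whichever alternative held before. The index of the minimum never has to be located.
  falling-or-rising : ∀ a i → F (a + i) ≤ F a ⊎ (∀ j → F (a + i) ≤ F (a + i + j))
  falling-or-rising a zero = inj₁ (≤-reflexive (cong F (+-identityʳ a)))
  falling-or-rising a (suc i) rewrite +-suc a i
    with falling-or-rising a i | ≤-total (F (a + i)) (F (suc (a + i)))
  ... | _ | inj₁ up = inj₂ (rising
        (+-cancelˡ-≤ (F (suc (a + i))) _ _ (≤-trans (cvx (a + i)) (+-monoˡ-≤ _ up))))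
  ... | inj₁ le | inj₂ dn = inj₁ (≤-trans dn le)
  ... | inj₂ up | inj₂ dn = inj₂ λ j →
        ≤-trans dn (≤-trans (up (suc j)) (≤-reflexive (cong F (+-suc (a + i) j))))

  max-at-ends : ∀ {a k b} → a ≤ k → k ≤ b → F k ≤ F a ⊔ F b
  max-at-ends {a} {k} {b} a≤k k≤b with falling-or-rising a (k ∸ a)
  ... | inj₁ le rewrite m+[n∸m]≡n a≤k = ≤-trans le (m≤m⊔n _ _)
  ... | inj₂ up rewrite m+[n∸m]≡n a≤k =
        ≤-trans (≤-trans (up (b ∸ k)) (≤-reflexive (cong F (m+[n∸m]≡n k≤b)))) (m≤n⊔m (F a) _)

+-convex : ∀ {F G} → Convex F → Convex G → Convex (λ k → F k + G k)
+-convex {F} {G} f g k = subst₂ _≤_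
  (interchange +-commutativeSemigroup (F (suc k)) _ (G (suc k)) _)
  (interchange +-commutativeSemigroup (F k) _ (G k) _)
  (+-mono-≤ (f k) (g k))

-- By Pascal's rule the first difference of `_C suc r` is `_C r`, which is monotone.
C-convex : ∀ r → Convex (_C r)
C-convex zero k = ≤-refl
C-convex (suc r) k = begin
  suc k C suc r + suc k C suc r               ≡⟨ cong (_+ suc k C suc r) (pascal k r) ⟩
  k C suc r + k C r + suc k C suc r           ≡⟨ +-assoc (k C suc r) _ _ ⟩
  k C suc r + (k C r + suc k C suc r)         ≤⟨ +-monoʳ-≤ (k C suc r) (+-monoˡ-≤ _ (C-mono r (n≤1+n k))) ⟩
  k C suc r + (suc k C r + suc k C suc r)     ≡⟨ cong (k C suc r +_) (nCk+nC[k+1]≡[n+1]C[k+1] (suc k) r) ⟩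
  k C suc r + suc (suc k) C suc r             ∎
  where open ≤-Reasoning

-- Beyond `M` the truncated subtraction makes the sequence constant. At that corner its values are
-- `F 1`, `F 0`, `F 0`, and there convexity amounts to `F 0 ≤ F 1`.
reflected-convex : ∀ {F} → Convex F → Increasing F → ∀ M → Convex (λ k → F (M ∸ k))
reflected-convex {F} c i zero k rewrite 0∸n≡0 k = ≤-refl
reflected-convex {F} c i (suc zero) zero = +-monoˡ-≤ (F 0) (i 0)
reflected-convex {F} c i (suc (suc M)) zero = ≤-trans (c M) (≤-reflexive (+-comm (F M) _))
reflected-convex {F} c i (suc M) (suc k) = reflected-convex {F} c i M k

-- For `c = 0` the second difference of k F(k) is k times that of F plus twice the step from F(k+1)
-- to F(k+2). A positive `c` is removed by shifting; where truncation occurs, the left side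
-- vanishes.
scaled-convex : ∀ {F} → Convex F → Increasing F → ∀ c → Convex (λ k → (k ∸ c) * F k)
scaled-convex {F} cv inc zero k = begin
  suc k * F (suc k) + suc k * F (suc k)
    ≡⟨ solve 2 (λ k y → (con 1 :+ k) :* y :+ (con 1 :+ k) :* y := k :* (y :+ y) :+ (y :+ y)) refl
         k (F (suc k)) ⟩
  k * (F (suc k) + F (suc k)) + (F (suc k) + F (suc k))
    ≤⟨ +-mono-≤ (*-monoʳ-≤ k (cv k)) (+-mono-≤ (inc (suc k)) (inc (suc k))) ⟩
  k * (F k + F (suc (suc k))) + (F (suc (suc k)) + F (suc (suc k)))
    ≡⟨ solve 3 (λ k x z → k :* (x :+ z) :+ (z :+ z) := k :* x :+ (con 2 :+ k) :* z) refl
         k (F k) (F (suc (suc k))) ⟩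
  k * F k + suc (suc k) * F (suc (suc k)) ∎
  where open ≤-Reasoning; open +-*-Solver
scaled-convex {F} cv inc (suc zero) zero = z≤n
scaled-convex {F} cv inc (suc (suc c)) zero = z≤n
scaled-convex {F} cv inc (suc c) (suc k) =
  scaled-convex {F ∘ suc} (cv ∘ suc) (inc ∘ suc) c k

-- For `t < k` this is the bound of `N-≤` with m = k - t - 1. In this arrangement of the
-- subtractions the first two terms fit `reflected-convex` and `scaled-convex`.
cliqueBound : (n t δ s k : ℕ) → ℕ
cliqueBound n t δ s k = ((n + t ∸ k) C s) + (k ∸ (t + 1)) * (k C (s ∸ 1)) + (δ C (s ∸ 1))

cliqueBound-convex : ∀ n t δ s → Convex (cliqueBound n t δ s)
cliqueBound-convex n t δ s = +-convex
  {λ k → (n + t ∸ k) C s + (k ∸ (t + 1)) * (k C (s ∸ 1))} {λ _ → δ C (s ∸ 1)}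
  (+-convex {λ k → (n + t ∸ k) C s} {λ k → (k ∸ (t + 1)) * (k C (s ∸ 1))}
    (reflected-convex {_C s} (C-convex s) (λ k → C-mono s (n≤1+n k)) (n + t))
    (scaled-convex {_C (s ∸ 1)} (C-convex (s ∸ 1)) (λ k → C-mono (s ∸ 1) (n≤1+n k)) (t + 1)))
  (λ _ → ≤-refl)

-- Otherwise `N-≤`, applied to a vertex `v₀` of degree `δ`, bounds `N s G` by `cliqueBound` at `k`,
-- and convexity bounds that by its larger value at the ends `δ` and `h n t`.
few-low-degrees : ∀ n s t δ → 1 ≤ s → t < δ → (G : Graph n) → HasMinDegree G δ →
  N s G > f₀ n t δ s ⊔ g₀ n t δ s →
  ∀ k → δ ≤ k → k ≤ h n t → # (degree≤? G k) (allFin n) < k ∸ t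
few-low-degrees n (suc r) t δ _ t<δ G (_ , v₀ , refl) big k δ≤k k≤h
  with (k ∸ t) ≤? # (degree≤? G k) (allFin n)
... | no ¬le = ≰⇒> ¬le
... | yes le = contradiction (≤-trans big (begin
  N (suc r) G
    ≤⟨ N-≤ G r (k ∸ (t + 1)) k v₀ δ≤k (≤-trans (≤-reflexive (sym (k∸t k δ≤k))) le) ⟩
  (n ∸ suc (k ∸ (t + 1))) C suc r + (k ∸ (t + 1)) * (k C r) + δ C r
    ≡⟨ cong (λ z → z C suc r + (k ∸ (t + 1)) * (k C r) + δ C r)
         (trans (cong (n ∸_) (sym (k∸t k δ≤k))) n∸) ⟩
  cliqueBound n t δ (suc r) k
    ≤⟨ max-at-ends {cliqueBound n t δ (suc r)} (cliqueBound-convex n t δ (suc r)) δ≤k k≤h ⟩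
  cliqueBound n t δ (suc r) δ ⊔ cliqueBound n t δ (suc r) (h n t)
    ≡⟨ cong₂ _⊔_ left right ⟩
  f₀ n t δ (suc r) ⊔ g₀ n t δ (suc r) ∎)) (<-irrefl refl)
  where
  open ≤-Reasoning
  k∸t : ∀ k → δ ≤ k → k ∸ t ≡ suc (k ∸ (t + 1))
  k∸t k δ≤k = trans (sym (m+[n∸m]≡n {1} (m<n⇒0<n∸m (≤-trans t<δ δ≤k)))) (cong suc (∸-+-assoc k t 1))
  n∸ : n ∸ (k ∸ t) ≡ n + t ∸ k
  n∸ = trans (sym ([m+n]∸[m+o]≡n∸o t n (k ∸ t)))
    (cong₂ _∸_ (+-comm t n) (m+[n∸m]≡n (≤-trans (<⇒≤ t<δ) δ≤k)))
  -- At k = δ the separate term for `v₀` equals the others, so δ - t - 1 copies become δ - t.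
  left : cliqueBound n t δ (suc r) δ ≡ f₀ n t δ (suc r)
  left = trans (+-assoc ((n + t ∸ δ) C suc r) _ _) (cong ((n + t ∸ δ) C suc r +_)
    (trans (+-comm ((δ ∸ (t + 1)) * (δ C r)) _) (cong (_* (δ C r)) (sym (k∸t δ ≤-refl)))))
  right : cliqueBound n t δ (suc r) (h n t) ≡ g₀ n t δ (suc r)
  right = cong (λ z → (n + t ∸ h n t) C suc r + z * (h n t C r) + δ C r) (sym (∸-+-assoc (h n t) t 1))

-- Lists without repetition

Unique-↭ : ∀ {A : Set} {xs ys : List A} → xs ↭ ys → Unique xs → Unique ys
Unique-↭ {A} σ = ↭ₛ.Unique-resp-↭ (setoid A) (↭.↭⇒↭ₛ σ)

Unique-++⁻ : ∀ {A : Set} xs {ys : List A} → Unique (xs ++ ys) →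
  Unique xs × Unique ys × (∀ {x} → x ∈ xs → All (x ≢_) ys)
Unique-++⁻ [] ys! = [] , ys! , λ ()
Unique-++⁻ (x ∷ xs) (x∉ ∷ !) with xs! , ys! , sep ← Unique-++⁻ xs !
                                | x∉xs , x∉ys ← All.++⁻ xs x∉ =
  x∉xs ∷ xs! , ys! , λ { (here refl) → x∉ys ; (there z) → sep z }

Unique-tabulate⁻ : ∀ {A : Set} {n} (f : Fin n → A) → Unique (tabulate f) → Injective _≡_ _≡_ f
Unique-tabulate⁻ f (_ ∷ _)  {zero}  {zero}  _ = refl
Unique-tabulate⁻ f (p ∷ _)  {zero}  {suc j} e = contradiction e (All.tabulate⁻ p j)
Unique-tabulate⁻ f (p ∷ _)  {suc i} {zero}  e = contradiction (sym e) (All.tabulate⁻ p i)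
Unique-tabulate⁻ f (_ ∷ !)  {suc i} {suc j} e = cong suc (Unique-tabulate⁻ (f ∘ suc) ! e)

∈-concat-tabulate⁻ : ∀ {A : Set} {n} {x : A} (l : Fin n → List A) →
  x ∈ concat (tabulate l) → ∃ λ i → x ∈ l i
∈-concat-tabulate⁻ {n = suc n} l x∈ with ∈-++⁻ (l zero) x∈
... | inj₁ x∈₀ = zero , x∈₀
... | inj₂ x∈₁ with i , x∈ᵢ ← ∈-concat-tabulate⁻ (l ∘ suc) x∈₁ = suc i , x∈ᵢ

∈-concat-tabulate⁺ : ∀ {A : Set} {n} {x : A} (l : Fin n → List A) i →
  x ∈ l i → x ∈ concat (tabulate l)
∈-concat-tabulate⁺ l zero    x∈ = ∈-++⁺ˡ x∈
∈-concat-tabulate⁺ l (suc i) x∈ = ∈-++⁺ʳ (l zero) (∈-concat-tabulate⁺ (l ∘ suc) i x∈)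

Unique-concat⁻ : ∀ {A : Set} {n} (l : Fin n → List A) → Unique (concat (tabulate l)) →
  (∀ i → Unique (l i)) × (∀ {x} i j → x ∈ l i → x ∈ l j → i ≡ j)
Unique-concat⁻ {n = zero} l _ = (λ ()) , λ ()
Unique-concat⁻ {n = suc n} l ! with l₀! , rest! , sep ← Unique-++⁻ (l zero) !
                               with ls! , same ← Unique-concat⁻ (l ∘ suc) rest! =
  (λ { zero → l₀! ; (suc i) → ls! i }) ,
  λ { zero    zero    _ _ → refl
    ; zero    (suc j) p q → contradiction refl (All.lookup (sep p) (∈-concat-tabulate⁺ (l ∘ suc) j q))
    ; (suc i) zero    p q → contradiction refl (All.lookup (sep q) (∈-concat-tabulate⁺ (l ∘ suc) i p))
    ; (suc i) (suc j) p q → cong suc (same i j p q) }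

-- Transporting membership along `σ` in both directions gives maps of indices, and injectivity of
-- `f` and `g` makes them mutually inverse.
tabulate-↭⇒permutation : ∀ {A : Set} {n} {f g : Fin n → A} →
  Injective _≡_ _≡_ f → Injective _≡_ _≡_ g → tabulate f ↭ tabulate g →
  Σ (Permutation′ n) λ τ → ∀ i → f i ≡ g (τ ⟨$⟩ʳ i)
tabulate-↭⇒permutation {f = f} {g} f-inj g-inj σ =
  permutation to from
    (λ j → g-inj (trans (sym (proj₂ (image (from j)))) (sym (proj₂ (preimage j)))))
    (λ i → f-inj (trans (sym (proj₂ (preimage (to i)))) (sym (proj₂ (image i))))) ,
  proj₂ ∘ image
  where
  image : ∀ i → ∃ λ j → f i ≡ g j
  image i = ∈-tabulate⁻ (∈-resp-↭ σ (∈-tabulate⁺ i))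
  preimage : ∀ j → ∃ λ i → g j ≡ f i
  preimage j = ∈-tabulate⁻ (∈-resp-↭ (↭-sym σ) (∈-tabulate⁺ j))
  to = proj₁ ∘ image
  from = proj₁ ∘ preimage

-- Walks and systems of walks

module _ {V : Set} (_~_ : Rel V 0ℓ) where

  data Walk : V → List V → V → Set where
    [_] : ∀ a → Walk a (a ∷ []) a
    _∷_ : ∀ {a b c l} → a ~ b → Walk b l c → Walk a (a ∷ l) c

  data System : List V → List V → List V → Set where
    []  : System [] [] []
    _∷_ : ∀ {a l b us vs ws} → Walk a l b → System us vs ws →
          System (a ∷ us) (b ∷ vs) (l ++ ws)

  -- Walks may repeat vertices and meet each other. When `W` lists every vertex once, `exhausts`
  -- makes them simple and disjoint.
  record Cover (U V W : List _) : Set where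
    constructor cover
    field
      {us vs ws} : List _
      system     : System us vs ws
      starts     : us ↭ U
      ends       : vs ↭ V
      exhausts   : ws ↭ W

module _ {V : Set} {_~_ : Rel V 0ℓ} where

  Cover-↭ : ∀ {U U′ V V′ W W′} → U ↭ U′ → V ↭ V′ → W ↭ W′ →
    Cover _~_ U V W → Cover _~_ U′ V′ W′
  Cover-↭ σ τ ρ (cover S s e x) = cover S (↭-trans s σ) (↭-trans e τ) (↭-trans x ρ)

  start∈ : ∀ {a l b} → Walk _~_ a l b → a ∈ l
  start∈ [ a ]   = here refl
  start∈ (_ ∷ _) = here refl

  end∈ : ∀ {a l b} → Walk _~_ a l b → b ∈ l
  end∈ [ a ]   = here refl
  end∈ (_ ∷ w) = there (end∈ w)

  join : ∀ {a k b c l d} → Walk _~_ a k b → b ~ c → Walk _~_ c l d → Walk _~_ a (k ++ l) d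
  join [ a ]   e w = e ∷ w
  join (f ∷ v) e w = f ∷ join v e w

  reverseWalk : Symmetric _~_ → ∀ {a l b} → Walk _~_ a l b → ∃ λ k → Walk _~_ b k a × k ↭ l
  reverseWalk symm [ a ] = a ∷ [] , [ a ] , ↭-refl
  reverseWalk symm {a} (e ∷ w) with k , v , σ ← reverseWalk symm w =
    k ++ a ∷ [] , join v (symm e) [ a ] , ↭-trans (++-comm k (a ∷ [])) (prep a σ)

  -- Puts the walks in a prescribed order of their starts, so that the `i`-th walk can be the one
  -- from `u i`.
  reorder : ∀ {us us′ vs ws} → System _~_ us vs ws → us ↭ us′ →
    ∃₂ λ vs′ ws′ → System _~_ us′ vs′ ws′ × vs ↭ vs′ × ws ↭ ws′
  reorder S ↭.refl = _ , _ , S , ↭-refl , ↭-refl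
  reorder (_∷_ {l = l} w S) (prep _ σ) with _ , _ , S′ , τ , ρ ← reorder S σ =
    _ , _ , w ∷ S′ , prep _ τ , ++⁺ˡ l ρ
  reorder (_∷_ {l = k} v (_∷_ {l = l} w S)) (swap _ _ σ) with _ , _ , S′ , τ , ρ ← reorder S σ =
    _ , _ , w ∷ v ∷ S′ , swap _ _ τ , ↭-trans (shifts k l) (++⁺ˡ l (++⁺ˡ k ρ))
  reorder S (↭.trans σ₁ σ₂) with _ , _ , S₁ , τ₁ , ρ₁ ← reorder S σ₁
                            with _ , _ , S₂ , τ₂ , ρ₂ ← reorder S₁ σ₂ =
    _ , _ , S₂ , ↭-trans τ₁ τ₂ , ↭-trans ρ₁ ρ₂

  components : ∀ {t vs ws} (u : Fin t → V) → System _~_ (tabulate u) vs ws →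
    ∃₂ λ v l → (∀ i → Walk _~_ (u i) (l i) (v i)) × vs ≡ tabulate v × ws ≡ concat (tabulate l)
  components {zero}  u [] = (λ ()) , (λ ()) , (λ ()) , refl , refl
  components {suc t} u (_∷_ {l = l₀} {b} w S) with v , l , ws , refl , refl ← components (u ∘ suc) S =
    (λ { zero → b ; (suc i) → v i }) , (λ { zero → l₀ ; (suc i) → l i }) ,
    (λ { zero → w ; (suc i) → ws i }) , refl , refl

  Walk⇒Linked : ∀ {a l b} → Walk _~_ a l b → Linked _~_ l
  Walk⇒Linked [ a ]             = [-]
  Walk⇒Linked (e ∷ [ b ])       = e ∷ [-]
  Walk⇒Linked (e ∷ w@(_ ∷ _))   = e ∷ Walk⇒Linked w

  Walk-head : ∀ {a l b} → Walk _~_ a l b → head l ≡ just a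
  Walk-head [ a ]   = refl
  Walk-head (_ ∷ _) = refl

  Walk-last : ∀ {a l b} → Walk _~_ a l b → last l ≡ just b
  Walk-last [ a ]           = refl
  Walk-last (_ ∷ [ b ])     = refl
  Walk-last (_ ∷ w@(_ ∷ _)) = Walk-last w

-- With the starts in order, the ends form a rearrangement of `v`, and this rearrangement is `τ`.
-- The concatenated vertex lists are a permutation of `allFin n`, so each list is free of
-- repetitions and each vertex lies in exactly one.
Cover⇒paths : ∀ {n} (G : Graph n) {t} (u v : Fin t → Fin n) → Injective _≡_ _≡_ v →
  Cover (Graph.Adj G) (tabulate u) (tabulate v) (allFin n) →
  Σ (Permutation′ t) λ τ →
  Σ ((i : Fin t) → Path G (u i) (v (τ ⟨$⟩ʳ i))) λ P →
    ∀ x → ∃! _≡_ (λ i → x ∈ Path.vertices (P i))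
Cover⇒paths {n} G u v v-inj (cover S σ τ ρ)
  with _ , _ , S′ , τ′ , ρ′ ← reorder S σ
  with v′ , l , walks , refl , refl ← components u S′ =
  π , paths , λ x → let i , x∈ = ∈-concat-tabulate⁻ l (∈-resp-↭ (↭-sym σW) (∈-allFin x)) in
                    i , x∈ , λ {j} x∈′ → same i j x∈ x∈′
  where
  σV = ↭-trans (↭-sym τ′) τ
  σW = ↭-trans (↭-sym ρ′) ρ
  decomposed = Unique-concat⁻ l (Unique-↭ (↭-sym σW) (Unique.allFin⁺ n))
  same = proj₂ decomposed
  matching = tabulate-↭⇒permutation
    (Unique-tabulate⁻ v′ (Unique-↭ (↭-sym σV) (Unique.tabulate⁺ v-inj))) v-inj σV
  π = proj₁ matching
  paths : ∀ i → Path G (u i) (v (π ⟨$⟩ʳ i))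
  paths i = record
    { vertices = l i
    ; linked   = Walk⇒Linked (walks i)
    ; distinct = proj₁ decomposed i
    ; starts   = Walk-head (walks i)
    ; ends     = trans (Walk-last (walks i)) (cong just (proj₂ matching i)) }

-- Complete graphs

module _ {V : Set} {_~_ : Rel V 0ℓ} (complete : ∀ {a b} → a ≢ b → a ~ b) where

  walkAlong : ∀ {a b} l → Unique (a ∷ l ++ b ∷ []) → Walk _~_ a (a ∷ l ++ b ∷ []) b
  walkAlong {b = b} []      ((a≢b ∷ _) ∷ _) = complete a≢b ∷ [ b ]
  walkAlong         (c ∷ l) ((a≢c ∷ _) ∷ !) = complete a≢c ∷ walkAlong l !

  edgeSystem : ∀ {t} (u v : Fin t → V) → (∀ i → u i ≢ v i) →
    ∃ λ ws → System _~_ (tabulate u) (tabulate v) ws × ws ↭ tabulate u ++ tabulate v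
  edgeSystem {zero}  u v u≢v = [] , [] , ↭-refl
  edgeSystem {suc t} u v u≢v with ws , S , σ ← edgeSystem (u ∘ suc) (v ∘ suc) (u≢v ∘ suc) =
    u zero ∷ v zero ∷ ws , (complete (u≢v zero) ∷ [ v zero ]) ∷ S ,
    prep (u zero) (↭-trans (prep (v zero) σ) (↭-sym (shift (v zero) (tabulate (u ∘ suc)) _)))

-- The first walk runs from `u zero` through every vertex outside both sets to `v zero`; each other
-- `u i` is joined to `v i` by a single edge.
complete⇒Cover : ∀ {n t} {_~_ : Rel (Fin n) 0ℓ} → (∀ {a b} → a ≢ b → a ~ b) →
  (u v : Fin (suc t) → Fin n) →
  Injective _≡_ _≡_ u → Injective _≡_ _≡_ v → (∀ i j → u i ≢ v j) →
  Cover _~_ (tabulate u) (tabulate v) (allFin n)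
complete⇒Cover {n} {t} {_~_} complete u v u-inj v-inj u≢v
  with ws , S , σ ← edgeSystem {_~_ = _~_} complete (u ∘ suc) (v ∘ suc) (λ i → u≢v (suc i) (suc i)) =
  cover (walkAlong {_~_ = _~_} complete rest walk! ∷ S) ↭-refl ↭-refl (↭-trans arrange total)
  where
  open DecMembership (_≟_ {n}) using (_∈?_)
  us = tabulate u
  vs = tabulate v
  free? : Decidable (λ x → x ∉ us × x ∉ vs)
  free? x = ¬? (x ∈? us) ×-dec ¬? (x ∈? vs)
  rest = filter free? (allFin n)
  L = us ++ vs ++ rest
  L! : Unique L
  L! = Unique.++⁺ (Unique.tabulate⁺ u-inj)
    (Unique.++⁺ (Unique.tabulate⁺ v-inj) (Unique.filter⁺ free? (Unique.allFin⁺ n))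
      λ (x∈vs , x∈rest) → proj₂ (proj₂ (∈-filter⁻ free? {xs = allFin n} x∈rest)) x∈vs)
    λ (x∈us , x∈) → sep x∈us (∈-++⁻ vs x∈)
    where
    sep : ∀ {x} → x ∈ us → ¬ (x ∈ vs ⊎ x ∈ rest)
    sep x∈us (inj₁ x∈vs) with i , p ← ∈-tabulate⁻ {f = u} x∈us | j , q ← ∈-tabulate⁻ {f = v} x∈vs =
      u≢v i j (trans (sym p) q)
    sep x∈us (inj₂ x∈rest) = proj₁ (proj₂ (∈-filter⁻ free? {xs = allFin n} x∈rest)) x∈us
  all∈L : ∀ x → x ∈ L
  all∈L x with x ∈? us | x ∈? vs
  ... | yes p | _     = ∈-++⁺ˡ p
  ... | no _  | yes q = ∈-++⁺ʳ us (∈-++⁺ˡ q)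
  ... | no ¬p | no ¬q = ∈-++⁺ʳ us (∈-++⁺ʳ vs (∈-filter⁺ free? (∈-allFin x) (¬p , ¬q)))
  total : L ↭ allFin n
  total = ∼bag⇒↭ (unique∧set⇒bag L! (Unique.allFin⁺ n)
    (λ {x} → mk⇔ (λ _ → ∈-allFin x) (λ _ → all∈L x)))
  arrange : (u zero ∷ rest ++ v zero ∷ []) ++ ws ↭ L
  arrange = prep (u zero) (↭-trans (↭-reflexive (++-assoc rest _ ws))
    (↭-trans (++-comm rest _) (↭-trans (prep (v zero) (++⁺ʳ rest σ))
    (↭-trans (prep (v zero) (↭-reflexive (++-assoc (tabulate (u ∘ suc)) _ rest)))
    (↭-sym (shift (v zero) (tabulate (u ∘ suc)) _))))))
  -- The walk is an initial segment of a rearrangement of `L`.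
  walk! : Unique (u zero ∷ rest ++ v zero ∷ [])
  walk! = proj₁ (Unique-++⁻ _ (Unique-↭ (↭-sym arrange) L!))

-- Crossings

module _ {V : Set} {_~_ : Rel V 0ℓ} where

  -- A walk cut at an edge `w w′`. Only the two pieces are kept, since rerouting drops that edge.
  record Crossing (R P : Pred V 0ℓ) (a : V) (l : List V) (b : V) : Set where
    constructor crossing
    field
      {w w′}      : V
      {l₁ l₂}     : List V
      before      : Walk _~_ a l₁ w
      after       : Walk _~_ w′ l₂ b
      Rw          : R w
      Pw′         : P w′
      splits      : l ≡ l₁ ++ l₂

  module _ {R P : Pred V 0ℓ} (R? : Decidable R) (P? : Decidable P) where

    -- Without a crossing, each edge w w′ has at most one of R w and P w′; the last two terms
    -- account for the start, which is never a w′, and the end, which is never a w.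
    crossing-or-few : ∀ {a l b} → Walk _~_ a l b → Crossing R P a l b ⊎
      (suc (# P? l + # R? l) ≤ length l + (# P? (a ∷ []) + # R? (b ∷ [])))
    crossing-or-few [ a ] = inj₂ ≤-refl
    crossing-or-few {a} (_∷_ {b = b} {c} {l} e w) with R? a ×-dec P? b
    ... | yes (ra , pb) = inj₁ (crossing [ a ] w ra pb refl)
    ... | no ¬both with crossing-or-few w
    ... | inj₁ (crossing v v′ r p refl) = inj₁ (crossing (e ∷ v) v′ r p refl)
    ... | inj₂ few = inj₂ (begin
      suc (# P? (a ∷ l) + # R? (a ∷ l))
        ≡⟨ cong₂ (λ p r → suc (p + r)) (#-++ P? (a ∷ []) l) (#-++ R? (a ∷ []) l) ⟩
      suc ((# P? (a ∷ []) + # P? l) + (# R? (a ∷ []) + # R? l))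
        ≡⟨ solve 4 (λ p q r s → con 1 :+ ((p :+ q) :+ (r :+ s)) := (p :+ r) :+ (con 1 :+ (q :+ s))) refl
             (# P? (a ∷ [])) (# P? l) (# R? (a ∷ [])) (# R? l) ⟩
      (# P? (a ∷ []) + # R? (a ∷ [])) + suc (# P? l + # R? l)
        ≤⟨ +-monoʳ-≤ (# P? (a ∷ []) + # R? (a ∷ [])) few ⟩
      (# P? (a ∷ []) + # R? (a ∷ [])) + (length l + (# P? (b ∷ []) + # R? (c ∷ [])))
        ≡⟨ solve 5 (λ p r m q s → (p :+ r) :+ (m :+ (q :+ s)) := (q :+ r) :+ (m :+ (p :+ s))) refl
             (# P? (a ∷ [])) (# R? (a ∷ [])) (length l) (# P? (b ∷ [])) (# R? (c ∷ [])) ⟩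
      (# P? (b ∷ []) + # R? (a ∷ [])) + (length l + (# P? (a ∷ []) + # R? (c ∷ [])))
        ≤⟨ +-monoˡ-≤ _ one ⟩
      suc (length l) + (# P? (a ∷ []) + # R? (c ∷ [])) ∎)
      where
      open ≤-Reasoning
      open +-*-Solver
      one : # P? (b ∷ []) + # R? (a ∷ []) ≤ 1
      one with R? a | P? b
      ... | yes ra | yes pb = contradiction (ra , pb) ¬both
      ... | yes _  | no _   = ≤-refl
      ... | no _   | yes _  = ≤-refl
      ... | no _   | no _   = z≤n

    record SystemCrossing (us vs ws : List V) : Set where
      constructor systemCrossing
      field
        {a b}         : V
        {l us′ vs′ ws′} : List V
        crossed       : Crossing R P a l b
        others        : System _~_ us′ vs′ ws′
        starts        : a ∷ us′ ↭ us
        ends          : b ∷ vs′ ↭ vs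
        exhausts      : l ++ ws′ ↭ ws

    -- Sum over the walks: the corrections for start and end are at most 1 each, so a walk without a
    -- crossing contributes at most one more than its length. This gives one extra unit per entry of
    -- `us`.
    systemCrossing-or-few : ∀ {us vs ws} → System _~_ us vs ws →
      SystemCrossing us vs ws ⊎ (# P? ws + # R? ws ≤ length ws + length us)
    systemCrossing-or-few [] = inj₂ z≤n
    systemCrossing-or-few (_∷_ {a} {l} {b} {us} {vs} {ws} w S) with crossing-or-few w
    ... | inj₁ c = inj₁ (systemCrossing c S ↭-refl ↭-refl ↭-refl)
    ... | inj₂ few with systemCrossing-or-few S
    ... | inj₁ (systemCrossing {l = k} c S′ σ τ ρ) = inj₁ (systemCrossing c (w ∷ S′)
            (↭-trans (swap _ _ ↭-refl) (prep _ σ)) (↭-trans (swap _ _ ↭-refl) (prep _ τ))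
            (↭-trans (shifts k l) (++⁺ˡ l ρ)))
    ... | inj₂ fews = inj₂ (begin
      # P? (l ++ ws) + # R? (l ++ ws)
        ≡⟨ cong₂ _+_ (#-++ P? l ws) (#-++ R? l ws) ⟩
      (# P? l + # P? ws) + (# R? l + # R? ws)
        ≡⟨ interchange +-commutativeSemigroup (# P? l) _ (# R? l) _ ⟩
      (# P? l + # R? l) + (# P? ws + # R? ws)
        ≤⟨ +-mono-≤ few₁ fews ⟩
      suc (length l) + (length ws + length us)
        ≡⟨ solve 3 (λ l w u → (con 1 :+ l) :+ (w :+ u) := (l :+ w) :+ (con 1 :+ u)) refl
             (length l) (length ws) (length us) ⟩
      (length l + length ws) + suc (length us)
        ≡⟨ cong (_+ suc (length us)) (length-++ l) ⟨
      length (l ++ ws) + suc (length us) ∎)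
      where
      open ≤-Reasoning
      open +-*-Solver
      few₁ : # P? l + # R? l ≤ suc (length l)
      few₁ = ≤-pred (≤-trans few (≤-trans
        (+-monoʳ-≤ (length l) (+-mono-≤ (#-∷-≤ P? a []) (#-∷-≤ R? b [])))
        (≤-reflexive (+-comm (length l) 2))))

-- Rerouting along a crossing

module _ {V : Set} {_~_ : Rel V 0ℓ}
  (_~?_ : Decidable₂ _~_) (symm : Symmetric _~_) (irrefl : Irreflexive _≡_ _~_) where

  -- A crossing on either half of the broken walk is repaired by reversing a segment.  On another
  -- walk it joins the walks with their ends exchanged, which is why the ends are matched to V only
  -- up to permutation.
  reconnect : ∀ {a l₁ x y l₂ b us vs ws} →
    Walk _~_ a l₁ x → Walk _~_ y l₂ b → System _~_ us vs ws →
    length ((l₁ ++ l₂) ++ ws) + length us <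
      # (x ~?_) ((l₁ ++ l₂) ++ ws) + # (y ~?_) ((l₁ ++ l₂) ++ ws) →
    Cover _~_ (a ∷ us) (b ∷ vs) ((l₁ ++ l₂) ++ ws)
  reconnect {a} {l₁} {x} {y} {l₂} {b} {us} {vs} {ws} p q S many
    with crossing-or-few (x ~?_) (y ~?_) p
  ... | inj₁ (crossing {l₁ = k₁} {k₂} p₁ p₂ xw yw′ refl) with k , p₂ʳ , σ ← reverseWalk symm p₂ =
    -- The new walk is a ⋯ w, x ⋯ w′, y ⋯ b, with the middle segment reversed.
    cover (join (join p₁ (symm xw) p₂ʳ) (symm yw′) q ∷ S) ↭-refl ↭-refl
      (++⁺ʳ ws (++⁺ʳ l₂ (++⁺ˡ k₁ σ)))
  ... | inj₂ few₁ with crossing-or-few (x ~?_) (y ~?_) q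
  ... | inj₁ (crossing {l₁ = k₁} {k₂} q₁ q₂ xw yw′ refl) with k , q₁ʳ , σ ← reverseWalk symm q₁ =
    -- The new walk is a ⋯ x, w ⋯ y, w′ ⋯ b, with the middle segment reversed.
    cover (join p xw (join q₁ʳ yw′ q₂) ∷ S) ↭-refl ↭-refl
      (++⁺ʳ ws (++⁺ˡ l₁ (++⁺ʳ k₂ σ)))
  ... | inj₂ few₂ with systemCrossing-or-few (y ~?_) (x ~?_) S
  ... | inj₁ (systemCrossing {b = d} {ws′ = ws′} (crossing {l₁ = k₁} {k₂} s₁ s₂ yw xw′ refl)
                             S′ σ τ ρ) =
    -- Here `y` is adjacent to `w` and `x` to `w′`: the new walks are a ⋯ x, w′ ⋯ d and the old
    -- start ⋯ w, y ⋯ b.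
    cover (join p xw′ s₂ ∷ join s₁ (symm yw) q ∷ S′)
      (prep a σ) (↭-trans (swap d b ↭-refl) (prep b τ))
      (↭-trans exchange (++⁺ˡ (l₁ ++ l₂) ρ))
    where
    exchange : (l₁ ++ k₂) ++ (k₁ ++ l₂) ++ ws′ ↭ (l₁ ++ l₂) ++ (k₁ ++ k₂) ++ ws′
    exchange = ↭-trans (↭-reflexive (++-assoc l₁ k₂ _))
      (↭-trans (++⁺ˡ l₁ inner) (↭-reflexive (sym (++-assoc l₁ l₂ _))))
      where
      inner : k₂ ++ (k₁ ++ l₂) ++ ws′ ↭ l₂ ++ (k₁ ++ k₂) ++ ws′
      inner = ↭-trans (++⁺ˡ k₂ (++⁺ʳ ws′ (++-comm k₁ l₂)))
        (↭-trans (++⁺ˡ k₂ (↭-reflexive (++-assoc l₂ k₁ ws′)))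
        (↭-trans (shifts k₂ l₂)
        (++⁺ˡ l₂ (↭-trans (shifts k₂ k₁) (↭-reflexive (sym (++-assoc k₁ k₂ ws′)))))))
  ... | inj₂ few₃ = contradiction (<-≤-trans many total) (<-irrefl refl)
    where
    open ≤-Reasoning
    x? = x ~?_
    y? = y ~?_
    -- Since `x` is not adjacent to itself, the correction at the end of `p` vanishes, and this half
    -- contributes at most its length. The same holds for `q`, which starts at `y`.
    few₁′ : # x? l₁ + # y? l₁ ≤ length l₁
    few₁′ = ≤-pred (begin
      suc (# x? l₁ + # y? l₁)                                 ≡⟨ cong suc (+-comm (# x? l₁) _) ⟩
      suc (# y? l₁ + # x? l₁)                                 ≤⟨ few₁ ⟩
      length l₁ + (# y? (a ∷ []) + # x? (x ∷ []))
        ≤⟨ +-monoʳ-≤ (length l₁)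
             (+-mono-≤ (#-∷-≤ y? a []) (≤-reflexive (#-no x? [] (irrefl refl)))) ⟩
      length l₁ + 1                                           ≡⟨ +-comm (length l₁) 1 ⟩
      suc (length l₁)                                         ∎)
    few₂′ : # x? l₂ + # y? l₂ ≤ length l₂
    few₂′ = ≤-pred (begin
      suc (# x? l₂ + # y? l₂)                                 ≡⟨ cong suc (+-comm (# x? l₂) _) ⟩
      suc (# y? l₂ + # x? l₂)                                 ≤⟨ few₂ ⟩
      length l₂ + (# y? (y ∷ []) + # x? (b ∷ []))
        ≤⟨ +-monoʳ-≤ (length l₂)
             (+-mono-≤ (≤-reflexive (#-no y? [] (irrefl refl))) (#-∷-≤ x? b [])) ⟩
      length l₂ + 1                                           ≡⟨ +-comm (length l₂) 1 ⟩
      suc (length l₂)                                         ∎)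
    regroup : ∀ k l → (# x? k + # y? k) + (# x? l + # y? l) ≡ # x? (k ++ l) + # y? (k ++ l)
    regroup k l = trans (interchange +-commutativeSemigroup (# x? k) _ (# x? l) _)
      (sym (cong₂ _+_ (#-++ x? k l) (#-++ y? k l)))
    -- Neither half of the broken walk gives an extra unit, so only the walks counted by `us` do.
    total : # x? ((l₁ ++ l₂) ++ ws) + # y? ((l₁ ++ l₂) ++ ws) ≤
            length ((l₁ ++ l₂) ++ ws) + length us
    total = begin
      # x? ((l₁ ++ l₂) ++ ws) + # y? ((l₁ ++ l₂) ++ ws)
        ≡⟨ regroup (l₁ ++ l₂) ws ⟨
      (# x? (l₁ ++ l₂) + # y? (l₁ ++ l₂)) + (# x? ws + # y? ws)
        ≡⟨ cong (_+ (# x? ws + # y? ws)) (regroup l₁ l₂) ⟨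
      ((# x? l₁ + # y? l₁) + (# x? l₂ + # y? l₂)) + (# x? ws + # y? ws)
        ≤⟨ +-mono-≤ (+-mono-≤ few₁′ few₂′) few₃ ⟩
      (length l₁ + length l₂) + (length ws + length us)
        ≡⟨ +-assoc (length l₁ + length l₂) (length ws) (length us) ⟨
      ((length l₁ + length l₂) + length ws) + length us
        ≡⟨ cong (λ z → (z + length ws) + length us) (length-++ l₁) ⟨
      (length (l₁ ++ l₂) + length ws) + length us
        ≡⟨ cong (_+ length us) (length-++ (l₁ ++ l₂)) ⟨
      length ((l₁ ++ l₂) ++ ws) + length us ∎

-- Removing the edge xy

data Link {V : Set} (x y : V) : Rel V 0ℓ where
  forth : Link x y x y
  back  : Link x y y x

module _ {V : Set} (_~_ : Rel V 0ℓ) (x y : V) where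

  _+link_ : Rel V 0ℓ
  _+link_ a b = a ~ b ⊎ Link x y a b

  record Broken (a : V) (l : List V) (b : V) : Set where
    constructor broken
    field
      {c d}   : V
      {l₁ l₂} : List V
      before  : Walk _~_ a l₁ c
      after   : Walk _~_ d l₂ b
      gap     : Link x y c d
      splits  : l ≡ l₁ ++ l₂

  -- Both orientations of the link pass through `c`, so a walk that misses `c` cannot use it.
  avoiding : ∀ {c d a l b} → Link x y c d → All (c ≢_) l → Walk _+link_ a l b → Walk _~_ a l b
  avoiding g c∉ [ a ] = [ a ]
  avoiding g (_ ∷ c∉) (inj₁ e ∷ w) = e ∷ avoiding g c∉ w
  avoiding forth (c≢ ∷ c∉) (inj₂ forth ∷ w) = contradiction refl c≢
  avoiding forth (_ ∷ c∉) (inj₂ back ∷ w) = contradiction refl (All.lookup c∉ (start∈ w))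
  avoiding back (_ ∷ c∉) (inj₂ forth ∷ w) = contradiction refl (All.lookup c∉ (start∈ w))
  avoiding back (c≢ ∷ c∉) (inj₂ back ∷ w) = contradiction refl c≢

  -- A walk without repetitions uses the link at most once: after the first use it never returns to
  -- the vertex it left.
  breakWalk : ∀ {a l b} → Unique l → Walk _+link_ a l b → Walk _~_ a l b ⊎ Broken a l b
  breakWalk _ [ a ] = inj₁ [ a ]
  breakWalk {a} (a∉ ∷ _) (inj₂ g ∷ w) = inj₂ (broken [ a ] (avoiding g a∉ w) g refl)
  breakWalk (_ ∷ l!) (inj₁ e ∷ w) with breakWalk l! w
  ... | inj₁ w′ = inj₁ (e ∷ w′)
  ... | inj₂ (broken p q g refl) = inj₂ (broken (e ∷ p) q g refl)

  avoidingSystem : ∀ {c d us vs ws} → Link x y c d → All (c ≢_) ws →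
    System _+link_ us vs ws → System _~_ us vs ws
  avoidingSystem g c∉ [] = []
  avoidingSystem g c∉ (_∷_ {l = l} w S) =
    avoiding g (All.++⁻ˡ l c∉) w ∷ avoidingSystem g (All.++⁻ʳ l c∉) S

  record BrokenSystem (us vs ws : List V) : Set where
    constructor brokenSystem
    field
      {a b}           : V
      {l us′ vs′ ws′} : List V
      brokenWalk      : Broken a l b
      others          : System _~_ us′ vs′ ws′
      starts          : a ∷ us′ ↭ us
      ends            : b ∷ vs′ ↭ vs
      exhausts        : l ++ ws′ ↭ ws

  -- At most one walk is broken, because an endpoint of the link lies on that walk and hence on none
  -- of the later ones.
  breakSystem : ∀ {us vs ws} → Unique ws → System _+link_ us vs ws →
    System _~_ us vs ws ⊎ BrokenSystem us vs ws
  breakSystem _ [] = inj₁ []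
  breakSystem ! (_∷_ {l = l} w S)
    with l! , ws! , sep ← Unique-++⁻ l !
    with breakWalk l! w
  ... | inj₂ B@(broken p q g refl) =
    inj₂ (brokenSystem B (avoidingSystem g (sep (∈-++⁺ˡ (end∈ p))) S) ↭-refl ↭-refl ↭-refl)
  ... | inj₁ w′ with breakSystem ws! S
  ... | inj₁ S′ = inj₁ (w′ ∷ S′)
  ... | inj₂ (brokenSystem {l = k} B S′ σ τ ρ) = inj₂ (brokenSystem B (w′ ∷ S′)
            (↭-trans (swap _ _ ↭-refl) (prep _ σ)) (↭-trans (swap _ _ ↭-refl) (prep _ τ))
            (↭-trans (shifts k l) (++⁺ˡ l ρ)))

module _ {n} (G : Graph n) where
  open Graph G

  addEdge : ∀ {x y} → x ≢ y → Graph n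
  addEdge {x} {y} x≢y = record
    { Adj    = _+link_ Adj x y
    ; adj?   = λ a b → adj? a b ⊎-dec link? a b
    ; symm   = λ { (inj₁ e) → inj₁ (symm e) ; (inj₂ forth) → inj₂ back ; (inj₂ back) → inj₂ forth }
    ; irrefl = λ { e (inj₁ f) → irrefl e f ; e (inj₂ forth) → x≢y e ; e (inj₂ back) → x≢y (sym e) } }
    where
    link? : Decidable₂ (Link x y)
    link? a b with a ≟ x | b ≟ y | a ≟ y | b ≟ x
    ... | yes refl | yes refl | _        | _        = yes forth
    ... | _        | _        | yes refl | yes refl = yes back
    -- Each orientation must fail in one of two coordinates, which makes four cases.
    ... | no a≢x   | _        | no a≢y   | _        = no λ { forth → a≢x refl ; back → a≢y refl }
    ... | no a≢x   | _        | _        | no b≢x   = no λ { forth → a≢x refl ; back → b≢x refl }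
    ... | _        | no b≢y   | no a≢y   | _        = no λ { forth → b≢y refl ; back → a≢y refl }
    ... | _        | no b≢y   | _        | no b≢x   = no λ { forth → b≢y refl ; back → b≢x refl }

  -- If the link is used, removing it leaves two halves and `t` - 1 intact walks. As their vertices
  -- are a permutation of `allFin n`, degrees can be counted along them, and `large` becomes the
  -- hypothesis of `reconnect`.
  closure : ∀ {t x y} (x≢y : x ≢ y) (u v : Fin t → Fin n) →
    n + t ≤ degree G x + degree G y →
    Cover (Graph.Adj (addEdge x≢y)) (tabulate u) (tabulate v) (allFin n) →
    Cover Adj (tabulate u) (tabulate v) (allFin n)
  closure {t} {x} {y} x≢y u v large (cover S σ τ ρ)
    with breakSystem Adj x y (Unique-↭ (↭-sym ρ) (Unique.allFin⁺ n)) S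
  ... | inj₁ S′ = cover S′ σ τ ρ
  ... | inj₂ (brokenSystem {us′ = us′} {ws′ = ws′} (broken {c} {d} {l₁} {l₂} p q g refl)
                           S′ σ′ τ′ ρ′) =
    Cover-↭ (↭-trans σ′ σ) (↭-trans τ′ τ) exhausts (reconnect adj? symm irrefl p q S′ (begin
      suc (length W + length us′)   ≡⟨ +-suc (length W) (length us′) ⟨
      length W + suc (length us′)   ≡⟨ cong₂ _+_
                                         (trans (↭-length exhausts) (length-tabulate {n = n} id))
                                         (trans (↭-length (↭-trans σ′ σ)) (length-tabulate u)) ⟩
      n + t                         ≤⟨ large ⟩
      degree G x + degree G y       ≡⟨ ends g ⟩
      degree G c + degree G d       ≡⟨ cong₂ _+_ (deg c) (deg d) ⟩
      # (adj? c) W + # (adj? d) W   ∎))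
    where
    open ≤-Reasoning
    W = (l₁ ++ l₂) ++ ws′
    exhausts : W ↭ allFin n
    exhausts = ↭-trans ρ′ ρ
    deg : ∀ z → degree G z ≡ # (adj? z) W
    deg z = trans (degree≡# G z) (sym (#-↭ (adj? z) exhausts))
    ends : ∀ {c d} → Link x y c d → degree G x + degree G y ≡ degree G c + degree G d
    ends forth = refl
    ends back  = +-comm (degree G x) _

  -- Extremal nonadjacent pairs

  NonAdjacent : Fin n × Fin n → Set
  NonAdjacent (a , b) = a ≢ b × ¬ Adj a b

  nonAdjacent? : Decidable NonAdjacent
  nonAdjacent? (a , b) = ¬? (a ≟ b) ×-dec ¬? (adj? a b)

  vertexPairs : List (Fin n × Fin n)
  vertexPairs = cartesianProduct (allFin n) (allFin n)

  nonAdjacents : ℕ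
  nonAdjacents = # nonAdjacent? vertexPairs

  degreeSum : Fin n × Fin n → ℕ
  degreeSum (a , b) = degree G a + degree G b

  complete-or-extremal : (∀ {a b} → a ≢ b → Adj a b) ⊎
    ∃ λ x → ∃ λ y → NonAdjacent (x , y) × degree G x ≤ degree G y ×
      (∀ p → NonAdjacent p → degreeSum p ≤ degreeSum (x , y))
  complete-or-extremal with filter nonAdjacent? vertexPairs in eq
  ... | [] = inj₁ adjacent
    where
    adjacent : ∀ {a b} → a ≢ b → Adj a b
    adjacent {a} {b} a≢b with adj? a b
    ... | yes e = e
    ... | no ¬e with () ← subst ((a , b) ∈_) eq
            (∈-filter⁺ nonAdjacent? (∈-cartesianProduct⁺ (∈-allFin a) (∈-allFin b)) (a≢b , ¬e))
  ... | c ∷ cs = inj₂ (oriented (≤-total (degree G x) (degree G y)))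
    where
    best = argmax degreeSum c (c ∷ cs)
    x = proj₁ best
    y = proj₂ best
    allNon : All NonAdjacent (c ∷ cs)
    allNon = subst (All NonAdjacent) eq (All.all-filter nonAdjacent? vertexPairs)
    non : NonAdjacent (x , y)
    non = argmax-all degreeSum {P = NonAdjacent} (All.head allNon) allNon
    maximal : ∀ p → NonAdjacent p → degreeSum p ≤ degreeSum (x , y)
    maximal (a , b) na = All.lookup (f[xs]≤f[argmax] {f = degreeSum} c (c ∷ cs))
      (subst ((a , b) ∈_) eq
        (∈-filter⁺ nonAdjacent? (∈-cartesianProduct⁺ (∈-allFin a) (∈-allFin b)) na))
    oriented : degree G x ≤ degree G y ⊎ degree G y ≤ degree G x → _
    oriented (inj₁ le) = x , y , non , le , maximal
    oriented (inj₂ le) = y , x , (proj₁ non ∘ sym , proj₂ non ∘ symm) , le ,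
      λ p na → ≤-trans (maximal p na) (≤-reflexive (+-comm (degree G x) _))

  degree-addEdge : ∀ {x y} (x≢y : x ≢ y) v → degree G v ≤ degree (addEdge x≢y) v
  degree-addEdge x≢y v = subst₂ _≤_ (sym (degree≡# G v)) (sym (degree≡# (addEdge x≢y) v))
    (#-mono (adj? v) (Graph.adj? (addEdge x≢y) v) (λ _ → inj₁) (allFin n))

  -- Let k be the degree of `x`. Then 2k ≤ d(x) + d(y) ≤ n + t - 1 gives k ≤ h. By maximality every
  -- nonneighbour of `y` other than `y` has degree at most k, and there are n - 1 - d(y) ≥ k - t of
  -- these.
  extremal-low-degrees : ∀ {t x y} → NonAdjacent (x , y) → degree G x ≤ degree G y →
    (∀ p → NonAdjacent p → degreeSum p ≤ degreeSum (x , y)) →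
    degreeSum (x , y) < n + t →
    degree G x ≤ h n t ×
    (t ≤ degree G x → degree G x ∸ t ≤ # (degree≤? G (degree G x)) (allFin n))
  extremal-low-degrees {t} {x} {y} (x≢y , _) dx≤dy maximal small = low , many
    where
    open ≤-Reasoning
    k = degree G x
    low : k ≤ h n t
    low = begin
      k                       ≡⟨ n≡⌊n+n/2⌋ k ⟩
      ⌊ k + k /2⌋             ≤⟨ ⌊n/2⌋-mono (≤-trans (+-monoʳ-≤ k dx≤dy) (∸-monoˡ-≤ 1 small)) ⟩
      h n t                   ∎
    lows = # (degree≤? G k) (allFin n)
    far : ∀ w → ¬ Adj y w → w ≡ y ⊎ degree G w ≤ k
    far w ¬yw with w ≟ y
    ... | yes e = inj₁ e
    ... | no w≢y = inj₂ (+-cancelʳ-≤ (degree G y) _ _ (maximal (w , y) (w≢y , ¬yw ∘ symm)))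
    -- The `suc` stands for `y`, a nonneighbour of itself whose degree may exceed `k`.
    count : n ≤ degree G y + suc lows
    count = begin
      n
        ≡⟨ length-tabulate {n = n} id ⟨
      length (allFin n)
        ≡⟨ #-complement (adj? y) (allFin n) ⟨
      # (adj? y) (allFin n) + # (¬? ∘ adj? y) (allFin n)
        ≤⟨ +-mono-≤ (≤-reflexive (sym (degree≡# G y)))
             (≤-trans (#-cover (_≟ y) (degree≤? G k) (¬? ∘ adj? y) far (allFin n))
                      (+-monoˡ-≤ lows (#-single y (Unique.allFin⁺ n)))) ⟩
      degree G y + suc lows ∎
    many : t ≤ k → k ∸ t ≤ lows
    many t≤k = m≤n+o⇒m∸n≤o k t (≤-pred (+-cancelˡ-≤ (degree G y) _ _ (begin
      degree G y + suc k          ≡⟨ trans (+-suc (degree G y) k) (cong suc (+-comm (degree G y) k)) ⟩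
      suc (k + degree G y)        ≤⟨ small ⟩
      n + t                       ≤⟨ +-monoˡ-≤ t count ⟩
      degree G y + suc lows + t   ≡⟨ trans (+-assoc (degree G y) _ t)
                                       (cong (λ z → degree G y + suc z) (+-comm lows t)) ⟩
      degree G y + suc (t + lows) ∎)))

-- Adding edges until the graph is complete

nonAdjacents-addEdge : ∀ {n} (G : Graph n) {x y} ((x≢y , _) : NonAdjacent G (x , y)) →
  nonAdjacents (addEdge G x≢y) < nonAdjacents G
nonAdjacents-addEdge G {x} {y} na@(x≢y , _) = #-strict (nonAdjacent? (addEdge G x≢y)) (nonAdjacent? G)
  (λ _ (a≢b , ¬e) → a≢b , ¬e ∘ inj₁)
  (∈-cartesianProduct⁺ (∈-allFin x) (∈-allFin y)) na (λ (_ , ¬e) → ¬e (inj₂ forth))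

-- Induction on a strict upper bound `m` for the number of nonadjacent ordered pairs. The hypotheses
-- concern degrees alone and survive the addition of an edge: degrees only grow, so vertices of low
-- degree only become fewer.
few-low-degrees⇒Cover : ∀ {n t δ} (u v : Fin (suc t) → Fin n) →
  Injective _≡_ _≡_ u → Injective _≡_ _≡_ v → (∀ i j → u i ≢ v j) → suc t ≤ δ →
  ∀ m (G : Graph n) → nonAdjacents G < m → (∀ x → δ ≤ degree G x) →
  (∀ k → δ ≤ k → k ≤ h n (suc t) → # (degree≤? G k) (allFin n) < k ∸ suc t) →
  Cover (Graph.Adj G) (tabulate u) (tabulate v) (allFin n)
few-low-degrees⇒Cover {n} {t} {δ} u v u-inj v-inj u≢v t<δ (suc m) G (s≤s non≤m) min few
  with complete-or-extremal G
... | inj₁ complete = complete⇒Cover {_~_ = Graph.Adj G} complete u v u-inj v-inj u≢v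
... | inj₂ (x , y , na@(x≢y , _) , dx≤dy , maximal) with n + suc t ≤? degree G x + degree G y
-- If even the largest degree sum is below n + t, then `few` fails at the degree of `x`.
... | no small with low , many ← extremal-low-degrees G na dx≤dy maximal (≰⇒> small) =
  contradiction (<-≤-trans (few (degree G x) (min x) low) (many (≤-trans t<δ (min x)))) (<-irrefl refl)
... | yes large = closure G x≢y u v large
  (few-low-degrees⇒Cover u v u-inj v-inj u≢v t<δ m G′ (<-≤-trans (nonAdjacents-addEdge G na) non≤m)
    (λ z → ≤-trans (min z) (degree-addEdge G x≢y z))
    (λ k δ≤k k≤h → ≤-<-trans
      (#-mono (degree≤? G′ k) (degree≤? G k) (λ z → ≤-trans (degree-addEdge G x≢y z)) (allFin n))
      (few k δ≤k k≤h)))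
  where G′ = addEdge G x≢y

theorem2p9 : (n s t δ : ℕ) → 2 ≤ s → 4 ≤ 2 * t → 2 * t ≤ δ → δ ≤ h n t →
    (G : Graph n) → Connected G → HasMinDegree G δ →
    N s G > f₀ n t δ s ⊔ g₀ n t δ s →
    ManyToManyDisjointPathCoverable G t
-- The case `t = 0` is excluded by `4 ≤ 2 * t`; for positive `t`, `2 * t ≤ δ` gives the strict
-- inequality `t < δ`.
theorem2p9 n s (suc t) δ 2≤s 4≤2t 2t≤δ δ≤h G _ minDegree big u v u-inj v-inj u≢v =
  Cover⇒paths G u v v-inj
    (few-low-degrees⇒Cover u v u-inj v-inj u≢v (<⇒≤ t<δ) (suc (nonAdjacents G)) G
      ≤-refl (proj₁ minDegree)
      (few-low-degrees n s (suc t) δ (<⇒≤ 2≤s) t<δ G minDegree big))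
  where
  t<δ : suc t < δ
  t<δ = <-≤-trans (m<m+n (suc t) (s≤s z≤n)) 2t≤δ
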